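{- The third order mock theta function $\psi_3(q)=\sum_{n\ge0}\frac{q^{n^2}}{(q;q^2)_n}$ is the generating function $\sum_\pi q^{|\pi|}$ over partitions $\pi$ with $n$ copies of $n$ (including the empty one) in which, with parts in ascending lexicographic order, the weighted difference between each part and the preceding one is exactly $0$, and the smallest part is of the form $j_j$.
   Context: $M=\{m_i: 1\le i\le m\}$; a partition with $n$ copies of $n$ is a finite multiset of elements of $M$, $|\pi|$ the sum of values. Lexicographic order: $m_i>n_j$ iff $m>n$, or $m=n$ and $i>j$. Weighted difference $((m_i-n_j))=m-n-i-j$. $(a;q)_n=\prod_{j=0}^{n-1}(1-aq^j)$. -}

module Defs where

open import Data.Fin.Base using (Fin; zero; suc; toℕ)
open import Data.Fin.Properties using (toℕ<n)
open import Data.Integer.Base as ℤ using (ℤ; +_; 0ℤ; 1ℤ)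
import Data.Integer.Properties as ℤ
open import Data.List.Base using (List; []; _∷_; map; head)
open import Data.List.Relation.Unary.Linked using (Linked)
open import Data.Maybe.Relation.Unary.All using (All)
open import Data.Nat.Base using (ℕ; zero; suc; _≤_; _<_; _∸_; z≤n; s≤s)
import Data.Nat.Base as ℕ
open import Data.Nat.ListAction using (sum)
import Data.Nat.Properties as ℕ
open import Data.Product.Base using (_×_; _,_; ∃-syntax; Σ-syntax)
open import Data.Product.Relation.Binary.Lex.Strict using (×-Lex)
open import Function.Bundles using (_↔_)
open import Relation.Binary.PropositionalEquality
  using (_≡_; refl; sym; trans; cong; cong₂; module ≡-Reasoning)

open import Algebra.Properties.Semiring.Sum ℤ.+-*-semiring
  using (sum-syntax; sum-cong-≗)

------------------------------------------------------------------------
-- Formal power series over ℤ, as coefficient sequences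

PowerSeries : Set
PowerSeries = ℕ → ℤ

infix  4 _≈_
infixl 6 _-_
infixl 7 _*_
infixr 8 _^_
infix  9 _⁻¹

_≈_ : PowerSeries → PowerSeries → Set
f ≈ g = ∀ n → f n ≡ g n

one : PowerSeries
one zero    = 1ℤ
one (suc _) = 0ℤ

q : PowerSeries
q 1 = 1ℤ
q _ = 0ℤ

_-_ : PowerSeries → PowerSeries → PowerSeries
(f - g) n = f n ℤ.- g n

_*_ : PowerSeries → PowerSeries → PowerSeries
(f * g) n = ∑[ i < suc n ] (f (toℕ i) ℤ.* g (n ∸ toℕ i))

_^_ : PowerSeries → ℕ → PowerSeries
f ^ zero  = one
f ^ suc n = f * (f ^ n)

-- Solving f * g ≈ one for g coefficient by coefficient, when f 0 ≡ 1:
--   g 0 = 1,   g (n + 1) = - ∑_{i ≤ n} f (i + 1) g (n - i).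
-- The entry of  inverseCoeffs f n  at i is g (n - i).
inverseCoeffs : PowerSeries → ∀ n → Fin (suc n) → ℤ
inverseCoeffs f zero    _       = 1ℤ
inverseCoeffs f (suc n) zero    =
  ℤ.- (∑[ i < suc n ] (f (suc (toℕ i)) ℤ.* inverseCoeffs f n i))
inverseCoeffs f (suc n) (suc i) = inverseCoeffs f n i

-- Only meaningful for series with constant term 1; see *-inverseʳ.
_⁻¹ : PowerSeries → PowerSeries
(f ⁻¹) n = inverseCoeffs f n zero

inverseCoeffs-⁻¹ : ∀ f n i → inverseCoeffs f n i ≡ (f ⁻¹) (n ∸ toℕ i)
inverseCoeffs-⁻¹ f zero    zero    = refl
inverseCoeffs-⁻¹ f (suc n) zero    = refl
inverseCoeffs-⁻¹ f (suc n) (suc i) = inverseCoeffs-⁻¹ f n i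

*-inverseʳ : ∀ f → f 0 ≡ 1ℤ → f * f ⁻¹ ≈ one
*-inverseʳ f f₀≡1 zero    = trans (ℤ.+-identityʳ _) (cong (ℤ._* 1ℤ) f₀≡1)
*-inverseʳ f f₀≡1 (suc n) = begin
  f 0 ℤ.* (ℤ.- S) ℤ.+ ∑[ i < suc n ] (f (suc (toℕ i)) ℤ.* (f ⁻¹) (n ∸ toℕ i))
    ≡⟨ cong₂ ℤ._+_ (trans (cong (ℤ._* (ℤ.- S)) f₀≡1) (ℤ.*-identityˡ _))
                   (sum-cong-≗ {suc n} λ i → cong (f (suc (toℕ i)) ℤ.*_)
                                          (sym (inverseCoeffs-⁻¹ f n i))) ⟩
  ℤ.- S ℤ.+ S
    ≡⟨ ℤ.+-inverseˡ S ⟩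
  0ℤ ∎
  where
  open ≡-Reasoning
  S = ∑[ i < suc n ] (f (suc (toℕ i)) ℤ.* inverseCoeffs f n i)

-- Convergence of ∑_{n ≥ 0} f n: each coefficient of the partial sums is
-- eventually constant.
HasSum : (ℕ → PowerSeries) → PowerSeries → Set
HasSum f s =
  ∀ N → ∃[ n₀ ] ∀ n → n₀ ≤ n → ∑[ k < n ] f (toℕ k) N ≡ s N

------------------------------------------------------------------------
-- The mock theta function

-- (a ; b)ₙ = ∏_{j < n} (1 - a bʲ)
⟨_⨾_⟩_ : PowerSeries → PowerSeries → ℕ → PowerSeries
⟨ a ⨾ b ⟩ zero  = one
⟨ a ⨾ b ⟩ suc n = (⟨ a ⨾ b ⟩ n) * (one - a * b ^ n)

ψ₃-term : ℕ → PowerSeries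
ψ₃-term n = q ^ (n ℕ.* n) * (⟨ q ⨾ q ^ 2 ⟩ n) ⁻¹

-- The n-th term has order n² ≥ n, so those with n > N do not contribute to
-- the coefficient of q^N; see ψ₃-hasSum.
ψ₃ : PowerSeries
ψ₃ N = ∑[ n < suc N ] ψ₃-term (toℕ n) N

qPoch-constant : ∀ n → (⟨ q ⨾ q ^ 2 ⟩ n) 0 ≡ 1ℤ
qPoch-constant zero    = refl
qPoch-constant (suc n) = trans (ℤ.+-identityʳ _) (cong (ℤ._* 1ℤ) (qPoch-constant n))

qPoch-inverse : ∀ n → (⟨ q ⨾ q ^ 2 ⟩ n) * (⟨ q ⨾ q ^ 2 ⟩ n) ⁻¹ ≈ one
qPoch-inverse n = *-inverseʳ (⟨ q ⨾ q ^ 2 ⟩ n) (qPoch-constant n)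

∑-zero : ∀ n (h : Fin n → ℤ) → (∀ i → h i ≡ 0ℤ) → ∑[ i < n ] h i ≡ 0ℤ
∑-zero zero    h h≡0 = refl
∑-zero (suc n) h h≡0 = cong₂ ℤ._+_ (h≡0 zero) (∑-zero n (λ i → h (suc i)) λ i → h≡0 (suc i))

∑-truncate : ∀ (h : ℕ → ℤ) {m n} → m ≤ n → (∀ k → m ≤ k → h k ≡ 0ℤ) →
             ∑[ k < n ] h (toℕ k) ≡ ∑[ k < m ] h (toℕ k)
∑-truncate h {n = n} z≤n  h≡0 = ∑-zero n (λ i → h (toℕ i)) λ i → h≡0 (toℕ i) z≤n
∑-truncate h (s≤s m≤n) h≡0 =
  cong (λ z → h 0 ℤ.+ z) (∑-truncate (λ k → h (suc k)) m≤n λ k m≤k → h≡0 (suc k) (s≤s m≤k))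

q^-order : ∀ k {n} → n < k → (q ^ k) n ≡ 0ℤ
q^-order (suc k) {zero}  _         = refl
q^-order (suc k) {suc n} (s≤s n<k) = begin
  0ℤ ℤ.+ (1ℤ ℤ.* (q ^ k) n ℤ.+ ∑[ i < n ] (0ℤ ℤ.* (q ^ k) (suc n ∸ suc (suc (toℕ i)))))
    ≡⟨ cong₂ (λ x y → 0ℤ ℤ.+ (1ℤ ℤ.* x ℤ.+ y)) (q^-order k n<k)
             (∑-zero n _ λ _ → refl) ⟩
  0ℤ ∎
  where open ≡-Reasoning

ψ₃-term-order : ∀ n {N} → N < n → ψ₃-term n N ≡ 0ℤ
ψ₃-term-order n@(suc _) {N} N<n = ∑-zero (suc N) _ λ i →
  cong (ℤ._* ((⟨ q ⨾ q ^ 2 ⟩ n) ⁻¹) (N ∸ toℕ i))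
       (q^-order (n ℕ.* n)
         (ℕ.<-≤-trans (toℕ<n i) (ℕ.≤-trans N<n (ℕ.m≤m*n n n))))

ψ₃-hasSum : HasSum ψ₃-term ψ₃
ψ₃-hasSum N = suc N , λ n N<n →
  ∑-truncate (λ k → ψ₃-term k N) N<n λ k N<k → ψ₃-term-order k N<k

------------------------------------------------------------------------
-- Partitions with n copies of n

-- The element m_i of M, with value m and subscript i.
record Part : Set where
  constructor part
  field
    value subscript : ℕ
    1≤subscript     : 1 ≤ subscript
    subscript≤value : subscript ≤ value

open Part public

infix 4 _≤ˡᵉˣ_

_≤ˡᵉˣ_ : Part → Part → Set
x ≤ˡᵉˣ y = ×-Lex _≡_ _<_ _≤_ (value x , subscript x) (value y , subscript y)

-- ((m_i - n_j)) = m - n - i - j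
weightedDifference : Part → Part → ℤ
weightedDifference x y =
  + value x ℤ.- + value y ℤ.- + subscript x ℤ.- + subscript y

-- A finite multiset of elements of M is represented by the unique listing of
-- its elements, with multiplicity, in ascending lexicographic order.
record Partition : Set where
  constructor partition
  field
    parts     : List Part
    ascending : Linked _≤ˡᵉˣ_ parts

open Partition public

∣_∣ : Partition → ℕ
∣ π ∣ = sum (map value (parts π))

ConsecutiveDifferencesZero : Partition → Set
ConsecutiveDifferencesZero π =
  Linked (λ x y → weightedDifference y x ≡ 0ℤ) (parts π)

-- Vacuous for the empty partition; otherwise the head is the smallest part.
SmallestPartDiagonal : Partition → Set
SmallestPartDiagonal π = All (λ x → value x ≡ subscript x) (head (parts π))

------------------------------------------------------------------------
-- Generating functions

-- F = ∑_π q^|π|, over the partitions π satisfying P: for each N, there are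
-- finitely many such π with |π| = N, and their number is the coefficient of
-- q^N in F.  The Σ-type below has exactly one element for each such π
-- provided that P is proof-irrelevant; Linked _≤ˡᵉˣ_ itself is.
IsGeneratingFunction : (Partition → Set) → PowerSeries → Set
IsGeneratingFunction P F =
  ∀ N → ∃[ k ] (Fin k ↔ (Σ[ π ∈ Partition ] P π × ∣ π ∣ ≡ N)) × F N ≡ + k

{-# OPTIONS --safe #-}

-- A partition whose consecutive weighted differences vanish and whose smallest
-- part is j_j is determined by its subscripts s₁, …, sₙ ≥ 1 in ascending order
-- of the parts: the values are s₁, 2s₁ + s₂, 2s₁ + 2s₂ + s₃, …, with sum
--   (2n - 1)s₁ + (2n - 3)s₂ + ⋯ + sₙ.
-- The number c n N of lists of n such subscripts with weighted sum N satisfies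
-- c (n+1) (2n+1+N) = c n N + c (n+1) N, according to whether s₁ = 1 or s₁ > 1
-- is decreased by one.  The coefficients of tₙ = q^(n²) / (q ; q²)ₙ satisfy the
-- same recurrence, because tₙ₊₁ (1 - q^(2n+1)) = q^(2n+1) tₙ.
module Submission where

open import Defs
open import Data.Product.Base using (_×_)

open import Algebra.Bundles using (CommutativeMonoid)
open import Axiom.UniquenessOfIdentityProofs using (module Decidable⇒UIP)
open import Data.Empty using (⊥-elim)
open import Data.Fin.Base using (Fin; zero; suc; toℕ; fromℕ<)
open import Data.Fin.Properties using (+↔⊎; toℕ-fromℕ<; toℕ-injective)
open import Data.Integer.Base as ℤ using (ℤ; +_; 0ℤ; 1ℤ)
import Data.Integer.Properties as ℤ
import Data.Integer.Tactic.RingSolver as ℤ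
open import Data.List.Base using (List; []; _∷_; length; map)
open import Data.List.Relation.Unary.Linked as Linked using (Linked; []; [-]; _∷_)
open import Data.Maybe.Relation.Unary.All as Maybe using (just; nothing)
open import Data.Nat.Base as ℕ using (ℕ; zero; suc; pred; _≤_; _<_; _∸_; z≤n; s≤s)
open import Data.Nat.Induction using (<-rec)
open import Data.Nat.ListAction using (sum)
import Data.Nat.Properties as ℕ
import Data.Nat.Tactic.RingSolver as ℕ
open import Data.Product.Base using (_,_; proj₁; proj₂; ∃-syntax; Σ-syntax)
open import Data.Sum.Base using (_⊎_; inj₁; inj₂)
open import Data.Sum.Function.Propositional using (_⊎-↔_)
open import Data.Unit.Base using (⊤; tt)
open import Function.Base using (_∘_)
open import Function.Bundles using (_↔_; mk↔ₛ′)
open import Function.Properties.Inverse using (↔-trans)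
open import Level using (0ℓ)
import Relation.Binary.Definitions as B
open import Relation.Binary.PropositionalEquality
  using (_≡_; refl; sym; trans; cong; cong₂; subst; module ≡-Reasoning)
open import Relation.Nullary.Negation using (¬_; contradiction)

open import Algebra.Properties.Semiring.Sum ℤ.+-*-semiring using (sum-syntax; sum-cong-≗)

-- Commutative monoid laws of the Cauchy product.

*-cong : ∀ {f g h k} → f ≈ g → h ≈ k → f * h ≈ g * k
*-cong f≈g h≈k n = sum-cong-≗ {suc n} λ i → cong₂ ℤ._*_ (f≈g (toℕ i)) (h≈k (n ∸ toℕ i))

*-congˡ : ∀ f {g h} → g ≈ h → f * g ≈ f * h
*-congˡ f = *-cong {f} λ _ → refl

*-congʳ : ∀ h {f g} → f ≈ g → f * h ≈ g * h
*-congʳ h f≈g = *-cong f≈g λ _ → refl {x = h _}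

*-identityˡ : ∀ f → one * f ≈ f
*-identityˡ f zero    = trans (ℤ.+-identityʳ _) (ℤ.*-identityˡ _)
*-identityˡ f (suc n) = trans
  (cong₂ ℤ._+_ (ℤ.*-identityˡ (f (suc n))) (∑-zero (suc n) _ λ _ → refl))
  (ℤ.+-identityʳ _)

-- The product rule dual to the definitional
--   (f * g) (suc n) ≡ f 0 ℤ.* g (suc n) ℤ.+ ((f ∘ suc) * g) n.
*-suc : ∀ f g n → (f * g) (suc n) ≡ (f * (g ∘ suc)) n ℤ.+ f (suc n) ℤ.* g 0
*-suc f g zero    = lemma (f 0) (f 1) (g 0) (g 1)
  where
  lemma : ∀ a b c d → a ℤ.* d ℤ.+ (b ℤ.* c ℤ.+ 0ℤ) ≡ (a ℤ.* d ℤ.+ 0ℤ) ℤ.+ b ℤ.* c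
  lemma = ℤ.solve-∀
*-suc f g (suc n) = trans
  (cong (λ z → f 0 ℤ.* g (suc (suc n)) ℤ.+ z) (*-suc (f ∘ suc) g n))
  (sym (ℤ.+-assoc (f 0 ℤ.* g (suc (suc n))) (((f ∘ suc) * (g ∘ suc)) n) _))

-- The definition splits off the term with `f 0` at the front of `f * g`, and `*-suc` splits off the
-- same term at the end of `g * f`; the remainders are the claim for `f ∘ suc` and `g`.
*-comm : ∀ f g → f * g ≈ g * f
*-comm f g zero    = cong (ℤ._+ 0ℤ) (ℤ.*-comm (f 0) (g 0))
*-comm f g (suc n) = begin
  f 0 ℤ.* g (suc n) ℤ.+ ((f ∘ suc) * g) n  ≡⟨ ℤ.+-comm (f 0 ℤ.* g (suc n)) _ ⟩
  ((f ∘ suc) * g) n ℤ.+ f 0 ℤ.* g (suc n)  ≡⟨ cong₂ ℤ._+_ (*-comm (f ∘ suc) g n) (ℤ.*-comm (f 0) _) ⟩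
  (g * (f ∘ suc)) n ℤ.+ g (suc n) ℤ.* f 0  ≡⟨ *-suc g f n ⟨
  (g * f) (suc n)                          ∎
  where open ≡-Reasoning

-- Shifting `f * g` by one gives `f 0` times `g ∘ suc` plus `(f ∘ suc) * g`, the combination met in
-- `*-assoc`; `c = -1` handles subtraction in `*-one-`.
*-linearˡ : ∀ c f g h n →
            ((λ i → c ℤ.* f i ℤ.+ g i) * h) n ≡ c ℤ.* (f * h) n ℤ.+ (g * h) n
*-linearˡ c f g h zero    = lemma c (f 0) (g 0) (h 0)
  where
  lemma : ∀ c a b x → (c ℤ.* a ℤ.+ b) ℤ.* x ℤ.+ 0ℤ ≡ c ℤ.* (a ℤ.* x ℤ.+ 0ℤ) ℤ.+ (b ℤ.* x ℤ.+ 0ℤ)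
  lemma = ℤ.solve-∀
*-linearˡ c f g h (suc n) = trans
  (cong (λ z → (c ℤ.* f 0 ℤ.+ g 0) ℤ.* h (suc n) ℤ.+ z)
        (*-linearˡ c (f ∘ suc) (g ∘ suc) h n))
  (lemma c (f 0) (g 0) (h (suc n)) (((f ∘ suc) * h) n) (((g ∘ suc) * h) n))
  where
  lemma : ∀ c a b x y z → (c ℤ.* a ℤ.+ b) ℤ.* x ℤ.+ (c ℤ.* y ℤ.+ z) ≡
                          c ℤ.* (a ℤ.* x ℤ.+ y) ℤ.+ (b ℤ.* x ℤ.+ z)
  lemma = ℤ.solve-∀

*-assoc : ∀ f g h → (f * g) * h ≈ f * (g * h)
*-assoc f g h zero    = lemma (f 0) (g 0) (h 0)
  where
  lemma : ∀ a b c → (a ℤ.* b ℤ.+ 0ℤ) ℤ.* c ℤ.+ 0ℤ ≡ a ℤ.* (b ℤ.* c ℤ.+ 0ℤ) ℤ.+ 0ℤ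
  lemma = ℤ.solve-∀
*-assoc f g h (suc n) = begin
  (f 0 ℤ.* g 0 ℤ.+ 0ℤ) ℤ.* h (suc n) ℤ.+
    ((λ i → f 0 ℤ.* g (suc i) ℤ.+ ((f ∘ suc) * g) i) * h) n
    ≡⟨ cong (λ z → (f 0 ℤ.* g 0 ℤ.+ 0ℤ) ℤ.* h (suc n) ℤ.+ z)
            (*-linearˡ (f 0) (g ∘ suc) ((f ∘ suc) * g) h n) ⟩
  (f 0 ℤ.* g 0 ℤ.+ 0ℤ) ℤ.* h (suc n) ℤ.+
    (f 0 ℤ.* ((g ∘ suc) * h) n ℤ.+ (((f ∘ suc) * g) * h) n)
    ≡⟨ lemma (f 0) (g 0) (h (suc n)) (((g ∘ suc) * h) n) ((((f ∘ suc) * g) * h) n) ⟩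
  f 0 ℤ.* (g * h) (suc n) ℤ.+ (((f ∘ suc) * g) * h) n
    ≡⟨ cong (λ z → f 0 ℤ.* (g * h) (suc n) ℤ.+ z) (*-assoc (f ∘ suc) g h n) ⟩
  f 0 ℤ.* (g * h) (suc n) ℤ.+ ((f ∘ suc) * (g * h)) n
    ∎
  where
  open ≡-Reasoning
  lemma : ∀ a b c d e → (a ℤ.* b ℤ.+ 0ℤ) ℤ.* c ℤ.+ (a ℤ.* d ℤ.+ e) ≡
                        a ℤ.* (b ℤ.* c ℤ.+ d) ℤ.+ e
  lemma = ℤ.solve-∀

*-commutativeMonoid : CommutativeMonoid 0ℓ 0ℓ
*-commutativeMonoid = record
  { Carrier = PowerSeries
  ; _≈_     = _≈_
  ; _∙_     = _*_
  ; ε       = one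
  ; isCommutativeMonoid = record
    { isMonoid = record
      { isSemigroup = record
        { isMagma = record
          { isEquivalence = record
            { refl  = λ _ → refl
            ; sym   = λ f≈g n → sym (f≈g n)
            ; trans = λ f≈g g≈h n → trans (f≈g n) (g≈h n)
            }
          ; ∙-cong = *-cong
          }
        ; assoc = *-assoc
        }
      ; identity = *-identityˡ , λ f n → trans (*-comm f one n) (*-identityˡ f n)
      }
    ; comm = *-comm
    }
  }

open CommutativeMonoid *-commutativeMonoid
  using (setoid)
  renaming (refl to ≈-refl; sym to ≈-sym; trans to ≈-trans)
open import Algebra.Solver.CommutativeMonoid *-commutativeMonoid using (solve; _⊜_; _⊕_)
import Relation.Binary.Reasoning.Setoid setoid as ≈-Reasoning

-- Inverses, powers, and multiplication by powers of `q` as a shift.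

⁻¹-*-cancelʳ : ∀ f g → f 0 ≡ 1ℤ → g 0 ≡ 1ℤ → (f * g) ⁻¹ * g ≈ f ⁻¹
⁻¹-*-cancelʳ f g f₀≡1 g₀≡1 = begin
  (f * g) ⁻¹ * g                ≈⟨ *-identityˡ _ ⟨
  -- The inserted `f * f ⁻¹` supplies the `f` that completes `g` to `f * g`, cancelling `(f * g) ⁻¹`
  -- and leaving `f ⁻¹`.
  one * ((f * g) ⁻¹ * g)        ≈⟨ *-congʳ ((f * g) ⁻¹ * g) (*-inverseʳ f f₀≡1) ⟨
  (f * f ⁻¹) * ((f * g) ⁻¹ * g)
    ≈⟨ solve 4 (λ a b c d → (a ⊕ b) ⊕ (c ⊕ d) ⊜ ((a ⊕ d) ⊕ c) ⊕ b) ≈-refl f (f ⁻¹) ((f * g) ⁻¹) g ⟩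
  ((f * g) * (f * g) ⁻¹) * f ⁻¹ ≈⟨ *-congʳ (f ⁻¹) (*-inverseʳ (f * g) fg₀≡1) ⟩
  one * f ⁻¹                    ≈⟨ *-identityˡ _ ⟩
  f ⁻¹                          ∎
  where
  open ≈-Reasoning
  fg₀≡1 : (f * g) 0 ≡ 1ℤ
  fg₀≡1 = trans (ℤ.+-identityʳ _) (cong₂ ℤ._*_ f₀≡1 g₀≡1)

^-+ : ∀ f m n → f ^ (m ℕ.+ n) ≈ f ^ m * f ^ n
^-+ f zero    n = ≈-sym (*-identityˡ (f ^ n))
^-+ f (suc m) n = ≈-trans (*-congˡ f (^-+ f m n)) (≈-sym (*-assoc f (f ^ m) (f ^ n)))

^-^ : ∀ f m n → (f ^ m) ^ n ≈ f ^ (n ℕ.* m)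
^-^ f m zero    = ≈-refl
^-^ f m (suc n) = ≈-trans (*-congˡ (f ^ m) (^-^ f m n)) (≈-sym (^-+ f m (n ℕ.* m)))

q* : ∀ f n → (q * f) (suc n) ≡ f n
q* f n = trans (ℤ.+-identityˡ _) (trans (*-congʳ f q∘suc≈one n) (*-identityˡ f n))
  where
  q∘suc≈one : (q ∘ suc) ≈ one
  q∘suc≈one zero    = refl
  q∘suc≈one (suc _) = refl

q^*-+ : ∀ k f N → (q ^ k * f) (k ℕ.+ N) ≡ f N
q^*-+ zero    f N = *-identityˡ f N
q^*-+ (suc k) f N = trans (*-assoc q (q ^ k) f (suc (k ℕ.+ N)))
                   (trans (q* (q ^ k * f) (k ℕ.+ N)) (q^*-+ k f N))

q^*-< : ∀ k f {N} → N < k → (q ^ k * f) N ≡ 0ℤ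
-- The constant coefficient of a multiple of `q` reduces to `0ℤ`.
q^*-< (suc k) f {zero}  _         = *-assoc q (q ^ k) f 0
q^*-< (suc k) f {suc N} (s≤s N<k) = trans (*-assoc q (q ^ k) f (suc N))
                                   (trans (q* (q ^ k * f) N) (q^*-< k f N<k))

*-one- : ∀ f g n → (f * (one - g)) n ≡ f n ℤ.- (g * f) n
*-one- f g n = begin
  (f * (one - g)) n                              ≡⟨ *-comm f (one - g) n ⟩
  ((one - g) * f) n                              ≡⟨ *-congʳ f (λ i → lemma (one i) (g i)) n ⟩
  ((λ i → ℤ.-1ℤ ℤ.* g i ℤ.+ one i) * f) n        ≡⟨ *-linearˡ ℤ.-1ℤ g one f n ⟩
  ℤ.-1ℤ ℤ.* (g * f) n ℤ.+ (one * f) n            ≡⟨ lemma _ ((g * f) n) ⟨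
  (one * f) n ℤ.- (g * f) n                      ≡⟨ cong (λ z → z ℤ.- (g * f) n) (*-identityˡ f n) ⟩
  f n ℤ.- (g * f) n                              ∎
  where
  open ≡-Reasoning
  lemma : ∀ a b → a ℤ.- b ≡ ℤ.-1ℤ ℤ.* b ℤ.+ a
  lemma = ℤ.solve-∀

-- Recurrence for the terms of the mock theta series.

odd : ℕ → ℕ
odd n = suc (n ℕ.* 2)

ψ₃-term-suc : ∀ n → ψ₃-term (suc n) * (one - q ^ odd n) ≈ q ^ odd n * ψ₃-term n
ψ₃-term-suc n = begin
  (q ^ (suc n ℕ.* suc n) * (P * G) ⁻¹) * (one - q ^ odd n)
    -- `^-^ q 2 n` produces the exponent `n * 2`; `odd` is written with it so that `q ^ odd n`
    -- unfolds to `q` times that power.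
    ≈⟨ *-congˡ (q ^ (suc n ℕ.* suc n) * (P * G) ⁻¹)
             (λ i → cong (λ z → one i ℤ.- z) (*-congˡ q (^-^ q 2 n) i)) ⟨
  (q ^ (suc n ℕ.* suc n) * (P * G) ⁻¹) * G
    ≈⟨ *-assoc (q ^ (suc n ℕ.* suc n)) ((P * G) ⁻¹) G ⟩
  q ^ (suc n ℕ.* suc n) * ((P * G) ⁻¹ * G)
    ≈⟨ *-congˡ (q ^ (suc n ℕ.* suc n)) (⁻¹-*-cancelʳ P G (qPoch-constant n) refl) ⟩
  q ^ (suc n ℕ.* suc n) * P ⁻¹
    ≡⟨ cong (λ m → q ^ m * P ⁻¹) (square n) ⟩
  q ^ (odd n ℕ.+ n ℕ.* n) * P ⁻¹
    ≈⟨ *-congʳ (P ⁻¹) (^-+ q (odd n) (n ℕ.* n)) ⟩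
  (q ^ odd n * q ^ (n ℕ.* n)) * P ⁻¹
    ≈⟨ *-assoc (q ^ odd n) (q ^ (n ℕ.* n)) (P ⁻¹) ⟩
  q ^ odd n * ψ₃-term n ∎
  where
  open ≈-Reasoning
  P G : PowerSeries
  P = ⟨ q ⨾ q ^ 2 ⟩ n
  G = one - q * (q ^ 2) ^ n

  square : ∀ n → suc n ℕ.* suc n ≡ suc (n ℕ.* 2) ℕ.+ n ℕ.* n
  square = ℕ.solve-∀

-- Moving the subtracted term across makes both summands shifts by `odd n`, which can be evaluated
-- separately below and from `odd n` on.
ψ₃-term-suc-coeff : ∀ n N → ψ₃-term (suc n) N ≡
                    (q ^ odd n * ψ₃-term n) N ℤ.+ (q ^ odd n * ψ₃-term (suc n)) N
ψ₃-term-suc-coeff n N = trans (lemma (ψ₃-term (suc n) N) _)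
  (cong (λ z → z ℤ.+ (q ^ odd n * ψ₃-term (suc n)) N)
        (trans (sym (*-one- (ψ₃-term (suc n)) (q ^ odd n) N)) (ψ₃-term-suc n N)))
  where
  lemma : ∀ a b → a ≡ (a ℤ.- b) ℤ.+ b
  lemma = ℤ.solve-∀

ψ₃-term-suc-+ : ∀ n N → ψ₃-term (suc n) (odd n ℕ.+ N) ≡ ψ₃-term n N ℤ.+ ψ₃-term (suc n) N
ψ₃-term-suc-+ n N = trans (ψ₃-term-suc-coeff n (odd n ℕ.+ N))
  (cong₂ ℤ._+_ (q^*-+ (odd n) (ψ₃-term n) N) (q^*-+ (odd n) (ψ₃-term (suc n)) N))

ψ₃-term-suc-< : ∀ n {N} → N < odd n → ψ₃-term (suc n) N ≡ 0ℤ
ψ₃-term-suc-< n {N} N<k = trans (ψ₃-term-suc-coeff n N)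
  (cong₂ ℤ._+_ (q^*-< (odd n) (ψ₃-term n) N<k) (q^*-< (odd n) (ψ₃-term (suc n)) N<k))

-- Enumeration of finite types.

Counted : Set → ℤ → Set
Counted A z = ∃[ k ] (Fin k ↔ A) × z ≡ + k

Counted-↔ : ∀ {A B z} → A ↔ B → Counted A z → Counted B z
Counted-↔ A↔B (k , Fin↔A , z≡k) = k , ↔-trans Fin↔A A↔B , z≡k

Counted-⊎ : ∀ {A B y z} → Counted A y → Counted B z → Counted (A ⊎ B) (y ℤ.+ z)
Counted-⊎ (k , Fin↔A , y≡k) (l , Fin↔B , z≡l) =
  k ℕ.+ l , ↔-trans +↔⊎ (Fin↔A ⊎-↔ Fin↔B) , cong₂ ℤ._+_ y≡k z≡l

Counted-empty : ∀ {A} → ¬ A → Counted A 0ℤ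
Counted-empty ¬A = 0 , mk↔ₛ′ (λ ()) (⊥-elim ∘ ¬A) (λ a → ⊥-elim (¬A a)) (λ ()) , refl

Counted-singleton : ∀ {A} (a : A) → (∀ b → a ≡ b) → Counted A 1ℤ
Counted-singleton a a≡ = 1 , mk↔ₛ′ (λ _ → a) (λ _ → zero) a≡ (λ { zero → refl }) , refl

Counted-Σ : ∀ {m} {B : Fin m → Set} {f : Fin m → ℤ} →
            (∀ i → Counted (B i) (f i)) → Counted (Σ[ i ∈ Fin m ] B i) (∑[ i < m ] f i)
Counted-Σ {zero}          counts = Counted-empty λ ()
Counted-Σ {suc m} {B} {f} counts =
  Counted-↔ split (Counted-⊎ (counts zero) (Counted-Σ (counts ∘ suc)))
  where
  split : (B zero ⊎ (Σ[ i ∈ Fin m ] B (suc i))) ↔ (Σ[ i ∈ Fin (suc m) ] B i)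
  split = mk↔ₛ′ (λ { (inj₁ b) → zero , b ; (inj₂ (i , b)) → suc i , b })
                (λ { (zero , b) → inj₁ b ; (suc i , b) → inj₂ (i , b) })
                (λ { (zero , b) → refl ; (suc i , b) → refl })
                (λ { (inj₁ b) → refl ; (inj₂ (i , b)) → refl })

-- Counting lists of subscripts by weight.

-- An entry i stands for the subscript i + 1, and the entries are listed from the
-- smallest part on.
weight : List ℕ → ℕ
weight []       = 0
weight (i ∷ is) = suc i ℕ.* odd (length is) ℕ.+ weight is

length≤weight : ∀ is → length is ≤ weight is
length≤weight []       = z≤n
length≤weight (i ∷ is) = ℕ.+-mono-≤ (ℕ.*-mono-≤ {1} {suc i} (s≤s z≤n) (s≤s z≤n)) (length≤weight is)

odd-length≤weight : ∀ i is → odd (length is) ≤ weight (i ∷ is)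
odd-length≤weight i is =
  ℕ.≤-trans (ℕ.m≤n*m (odd (length is)) (suc i)) (ℕ.m≤m+n _ (weight is))

Codes : ℕ → ℕ → Set
Codes n N = Σ[ is ∈ List ℕ ] length is ≡ n × weight is ≡ N

Codes-≡ : ∀ {n N} {x y : Codes n N} → proj₁ x ≡ proj₁ y → x ≡ y
Codes-≡ {x = is , l , w} {y = _ , l′ , w′} refl =
  cong₂ (λ l w → is , l , w) (ℕ.≡-irrelevant l l′) (ℕ.≡-irrelevant w w′)

-- The head entry `i` of a list of length `suc n` contributes `suc i` times `odd n`, so deleting a
-- head `zero` and decreasing a head `suc i` both lower the weight by exactly `odd n`.
Codes-suc : ∀ n N → (Codes n N ⊎ Codes (suc n) N) ↔ Codes (suc n) (odd n ℕ.+ N)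
Codes-suc n N = mk↔ₛ′ to from to∘from from∘to
  where
  to : Codes n N ⊎ Codes (suc n) N → Codes (suc n) (odd n ℕ.+ N)
  to (inj₁ (is , refl , w)) = zero ∷ is , refl , cong₂ ℕ._+_ (ℕ.+-identityʳ _) w
  to (inj₂ (i ∷ is , refl , w)) = suc i ∷ is , refl ,
    trans (ℕ.+-assoc (odd n) (suc i ℕ.* odd n) _) (cong (odd n ℕ.+_) w)

  from : Codes (suc n) (odd n ℕ.+ N) → Codes n N ⊎ Codes (suc n) N
  from (zero ∷ is , refl , w) = inj₁ (is , refl ,
    ℕ.+-cancelˡ-≡ (odd n) _ _ (trans (cong (ℕ._+ weight is) (sym (ℕ.+-identityʳ (odd n)))) w))
  from (suc i ∷ is , refl , w) = inj₂ (i ∷ is , refl ,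
    ℕ.+-cancelˡ-≡ (odd n) _ _ (trans (sym (ℕ.+-assoc (odd n) (suc i ℕ.* odd n) _)) w))

  to∘from : ∀ x → to (from x) ≡ x
  to∘from (zero  ∷ is , refl , w) = Codes-≡ refl
  to∘from (suc i ∷ is , refl , w) = Codes-≡ refl

  from∘to : ∀ x → from (to x) ≡ x
  from∘to (inj₁ (is , refl , w))     = cong inj₁ (Codes-≡ refl)
  from∘to (inj₂ (i ∷ is , refl , w)) = cong inj₂ (Codes-≡ refl)

Codes-< : ∀ n {N} → N < odd n → ¬ Codes (suc n) N
Codes-< n N<k (i ∷ is , refl , refl) = ℕ.<⇒≱ N<k (odd-length≤weight i is)

-- The recurrence lowers either the length or, at the same length, the weight: hence structural
-- induction on `n` with well-founded induction on `N` inside.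
Counted-Codes : ∀ n N → Counted (Codes n N) (ψ₃-term n N)
Counted-Codes zero zero = Counted-singleton ([] , refl , refl)
  λ { ([] , _ , _) → Codes-≡ refl }
-- `ψ₃-term 0` unfolds to `one * one ⁻¹`.
Counted-Codes zero (suc N) = subst (Counted _) (sym (*-inverseʳ one refl (suc N)))
  (Counted-empty λ { ([] , _ , ()) })
Counted-Codes (suc n) = <-rec _ step
  where
  step : ∀ N → (∀ {M} → M < N → Counted (Codes (suc n) M) (ψ₃-term (suc n) M)) →
         Counted (Codes (suc n) N) (ψ₃-term (suc n) N)
  step N rec with ℕ.<-≤-connex N (odd n)
  ... | inj₁ N<k = subst (Counted _) (sym (ψ₃-term-suc-< n N<k)) (Counted-empty (Codes-< n N<k))
  ... | inj₂ k≤N with M , refl ← ℕ.m≤n⇒∃[o]m+o≡n k≤N =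
    subst (Counted _) (sym (ψ₃-term-suc-+ n M))
      (Counted-↔ (Codes-suc n M)
        (Counted-⊎ (Counted-Codes n M) (rec (ℕ.m<n+m M (s≤s z≤n)))))

-- Every entry adds at least one to the weight, so a list of weight `N` has length at most `N`,
-- within the range summed in `ψ₃ N`.
Σ-Codes : ∀ N → (Σ[ n ∈ Fin (suc N) ] Codes (toℕ n) N) ↔ (Σ[ is ∈ List ℕ ] weight is ≡ N)
Σ-Codes N = mk↔ₛ′ (λ (_ , is , _ , w) → is , w) from (λ _ → refl)
  λ (n , is , l , w) → same-length (trans (toℕ-fromℕ< _) l)
  where
  length<1+N : ∀ is → weight is ≡ N → length is < suc N
  length<1+N is w = s≤s (subst (length is ≤_) w (length≤weight is))

  from : (Σ[ is ∈ List ℕ ] weight is ≡ N) → Σ[ n ∈ Fin (suc N) ] Codes (toℕ n) N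
  from (is , w) = fromℕ< (length<1+N is w) , is , sym (toℕ-fromℕ< _) , w

  same-length : ∀ {m n : Fin (suc N)} {is p r} → toℕ m ≡ toℕ n →
                _≡_ {A = Σ[ n ∈ Fin (suc N) ] Codes (toℕ n) N} (m , is , p) (n , is , r)
  same-length {m} m≡n with refl ← toℕ-injective m≡n =
    cong (m ,_) (Codes-≡ refl)

-- Proof irrelevance for admissible partitions.

≤ˡᵉˣ-irrelevant : B.Irrelevant _≤ˡᵉˣ_
≤ˡᵉˣ-irrelevant (inj₁ p)       (inj₁ r)         = cong inj₁ (ℕ.<-irrelevant p r)
≤ˡᵉˣ-irrelevant (inj₁ p)       (inj₂ (e , _))   = contradiction p (ℕ.<-irrefl e)
≤ˡᵉˣ-irrelevant (inj₂ (e , _)) (inj₁ r)         = contradiction r (ℕ.<-irrefl e)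
≤ˡᵉˣ-irrelevant (inj₂ (e , p)) (inj₂ (e′ , p′)) =
  cong inj₂ (cong₂ _,_ (ℕ.≡-irrelevant e e′) (ℕ.≤-irrelevant p p′))

Partition-≡ : ∀ {π ρ} → parts π ≡ parts ρ → π ≡ ρ
Partition-≡ {partition xs a} {partition _ b} refl =
  cong (partition xs) (Linked.irrelevant (λ {x} {y} → ≤ˡᵉˣ-irrelevant {x} {y}) a b)

Part-≡ : ∀ {x y} → value x ≡ value y → subscript x ≡ subscript y → x ≡ y
Part-≡ {part m i p r} {part _ _ p′ r′} refl refl =
  cong₂ (part m i) (ℕ.≤-irrelevant p p′) (ℕ.≤-irrelevant r r′)

Admissible : ℕ → Partition → Set
Admissible N π = (ConsecutiveDifferencesZero π × SmallestPartDiagonal π) × ∣ π ∣ ≡ N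

Admissible-irrelevant : ∀ {N} π (a b : Admissible N π) → a ≡ b
Admissible-irrelevant π ((c , s) , e) ((c′ , s′) , e′) = cong₂ _,_
  (cong₂ _,_ (Linked.irrelevant (Decidable⇒UIP.≡-irrelevant ℤ._≟_) c c′)
             (Maybe.irrelevant ℕ.≡-irrelevant s s′))
  (ℕ.≡-irrelevant e e′)

Admissible-≡ : ∀ {N} {x y : Σ[ π ∈ Partition ] Admissible N π} →
               parts (proj₁ x) ≡ parts (proj₁ y) → x ≡ y
Admissible-≡ {x = π , a} {y = ρ , b} xs≡ys with refl ← Partition-≡ {π} {ρ} xs≡ys =
  cong (π ,_) (Admissible-irrelevant π a b)

-- Correspondence between subscript lists and partitions.

-- Here s is value plus subscript of the part preceding the list.  With s = 0
-- the condition on the head x says that x is of the form j_j.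
Successive : ℕ → List Part → Set
Successive s []       = ⊤
Successive s (x ∷ xs) = value x ≡ s ℕ.+ subscript x × Successive (value x ℕ.+ subscript x) xs

-- Collecting the subtracted terms under one `+_` turns a vanishing difference into an equation
-- between natural numbers.
weightedDifference-≡ : ∀ x y → weightedDifference y x ≡
                       + value y ℤ.- + (value x ℕ.+ subscript x ℕ.+ subscript y)
weightedDifference-≡ x y = lemma (+ value y) (+ value x) (+ subscript y) (+ subscript x)
  where
  lemma : ∀ m n i j → m ℤ.- n ℤ.- i ℤ.- j ≡ m ℤ.- (n ℤ.+ j ℤ.+ i)
  lemma = ℤ.solve-∀

linked⇒successive : ∀ {x xs} → Linked (λ x y → weightedDifference y x ≡ 0ℤ) (x ∷ xs) →
                    Successive (value x ℕ.+ subscript x) xs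
linked⇒successive [-] = tt
linked⇒successive (_∷_ {x} {y} d ds) =
  ℤ.+-injective (ℤ.i-j≡0⇒i≡j _ _ (trans (sym (weightedDifference-≡ x y)) d)) ,
  linked⇒successive ds

successive⇒linked : ∀ {x xs} → Successive (value x ℕ.+ subscript x) xs →
                    Linked (λ x y → weightedDifference y x ≡ 0ℤ) (x ∷ xs)
successive⇒linked {xs = []}         _       = [-]
successive⇒linked {x} {xs = y ∷ xs} (e , s) =
  trans (weightedDifference-≡ x y) (ℤ.i≡j⇒i-j≡0 (cong +_ e)) ∷ successive⇒linked s

-- Each value exceeds the previous one by two subscripts, the later of which is positive, so the
-- values alone decide the order.
successive⇒ascending : ∀ {x xs} → Successive (value x ℕ.+ subscript x) xs → Linked _≤ˡᵉˣ_ (x ∷ xs)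
successive⇒ascending {xs = []}         _       = [-]
successive⇒ascending {x} {xs = y ∷ xs} (e , s) =
  inj₁ (subst (value x <_) (sym e)
         (ℕ.≤-<-trans (ℕ.m≤m+n _ _) (ℕ.m<m+n _ (1≤subscript y))))
  ∷ successive⇒ascending s

decode : ℕ → List ℕ → List Part
decode s []       = []
decode s (i ∷ is) =
  part (s ℕ.+ suc i) (suc i) (s≤s z≤n) (ℕ.m≤n+m (suc i) s) ∷ decode (s ℕ.+ suc i ℕ.+ suc i) is

encode : List Part → List ℕ
encode = map (pred ∘ subscript)

decode-successive : ∀ s is → Successive s (decode s is)
decode-successive s []       = tt
decode-successive s (i ∷ is) = refl , decode-successive _ is

encode-decode : ∀ s is → encode (decode s is) ≡ is
encode-decode s []       = refl
encode-decode s (i ∷ is) = cong (i ∷_) (encode-decode _ is)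

decode-encode : ∀ s xs → Successive s xs → decode s (encode xs) ≡ xs
decode-encode s []                               _           = refl
-- `1≤subscript` rules out subscript zero, so `pred` loses nothing; matching `refl` fixes the value.
decode-encode s (x@(part _ (suc i) _ _) ∷ xs) (refl , s-xs) =
  cong₂ _∷_ (Part-≡ refl refl) (decode-encode _ xs s-xs)

-- The offset `s` enters every value once. A subscript enters its own value once and each later
-- value twice, whence its factor `odd (length is)` in `weight`.
sum-decode : ∀ s is → sum (map value (decode s is)) ≡ s ℕ.* length is ℕ.+ weight is
sum-decode s []       = sym (trans (ℕ.+-identityʳ _) (ℕ.*-zeroʳ s))
sum-decode s (i ∷ is) = trans
  (cong (s ℕ.+ suc i ℕ.+_) (sum-decode _ is))
  (lemma s i (length is) (weight is))
  where
  lemma : ∀ s i l w → s ℕ.+ suc i ℕ.+ ((s ℕ.+ suc i ℕ.+ suc i) ℕ.* l ℕ.+ w) ≡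
                      s ℕ.* suc l ℕ.+ (suc i ℕ.* suc (l ℕ.* 2) ℕ.+ w)
  lemma = ℕ.solve-∀

admissible⇒successive : ∀ {N} π → Admissible N π → Successive 0 (parts π)
admissible⇒successive (partition []       _) _                  = tt
admissible⇒successive (partition (x ∷ xs) _) ((c , just d) , _) = d , linked⇒successive c

Codes↔Admissible : ∀ N → (Σ[ is ∈ List ℕ ] weight is ≡ N) ↔ (Σ[ π ∈ Partition ] Admissible N π)
Codes↔Admissible N = mk↔ₛ′ to from to∘from
  λ (is , _) → weighted-≡ (encode-decode 0 is)
  where
  fromList : List ℕ → Partition
  fromList is = partition (decode 0 is) (asc is)
    where
    asc : ∀ is → Linked _≤ˡᵉˣ_ (decode 0 is)
    asc []       = []
    asc (i ∷ is) = successive⇒ascending (decode-successive _ is)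

  admissible : ∀ is → Admissible (weight is) (fromList is)
  admissible []       = ([] , nothing) , refl
  admissible (i ∷ is) =
    (successive⇒linked (decode-successive _ is) , just refl) , sum-decode 0 (i ∷ is)

  to : (Σ[ is ∈ List ℕ ] weight is ≡ N) → Σ[ π ∈ Partition ] Admissible N π
  -- Only the proof is transported along `w`, so the list of parts still computes when
  -- `Admissible-≡` compares it.
  to (is , w) = fromList is , subst (λ N → Admissible N (fromList is)) w (admissible is)

  from : (Σ[ π ∈ Partition ] Admissible N π) → Σ[ is ∈ List ℕ ] weight is ≡ N
  from (π , a) = encode (parts π) ,
    trans (sym (sum-decode 0 (encode (parts π))))
      (trans (cong (sum ∘ map value) (decode-encode 0 (parts π) (admissible⇒successive π a)))
             (proj₂ a))

  weighted-≡ : {x y : Σ[ is ∈ List ℕ ] weight is ≡ N} → proj₁ x ≡ proj₁ y → x ≡ y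
  weighted-≡ {is , w} {_ , w′} refl = cong (is ,_) (ℕ.≡-irrelevant w w′)

  to∘from : ∀ x → to (from x) ≡ x
  to∘from (π , a) = Admissible-≡ (decode-encode 0 (parts π) (admissible⇒successive π a))

theorem27 : IsGeneratingFunction (λ π → ConsecutiveDifferencesZero π × SmallestPartDiagonal π) ψ₃
-- The goal at `N` unfolds to `Counted` at `ψ₃ N`, which is the sum over `Fin (suc N)` that
-- `Counted-Σ` produces.
theorem27 N = Counted-↔ (↔-trans (Σ-Codes N) (Codes↔Admissible N))
  (Counted-Σ {suc N} λ i → Counted-Codes (toℕ i) N)
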